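{- Let $\mathcal{Q}$ be a small quantaloid in which $1_q=\top_q:q\to q$ for all $q\in\mathcal{Q}_0$ and $\{\bot_q\}_{q\in\mathcal{Q}_0}$ is a cyclic family, where $\top_q$ and $\bot_q$ denote the top and bottom arrows in $\mathcal{Q}(q,q)$, respectively. Then the following statements are equivalent: (i) $\{\bot_q\}_{q\in\mathcal{Q}_0}$ is a dualizing family, hence $\mathcal{Q}$ is a Girard quantaloid. (ii) There exists a codense $\mathcal{Q}$-functor $F:\mathbb{A}\to\mathsf{P}\mathbb{A}$ for any $\mathcal{Q}$-category $\mathbb{A}$.
   Context: A quantaloid $\mathcal{Q}$ is a category whose hom-sets are complete lattices and whose composition $\circ$ preserves joins in each variable; small means it has a set $\mathcal{Q}_0$ of objects; $1_q$ denotes identities. For $u:p\to q$, $v:q\to r$, $w:p\to r$, the implications $w\swarrow u:q\to r$ and $v\searrow w:p\to q$ are determined by $v\circ u\leq w\iff v\leq w\swarrow u\iff u\leq v\searrow w$. A family $\{d_q:q\to q\}_{q\in\mathcal{Q}_0}$ is cyclic if $d_p\swarrow u=u\searrow d_q$ for all $u:p\to q$, and dualizing if $(d_p\swarrow u)\searrow d_p=u=d_q\swarrow(u\searrow d_q)$ for all $u:p\to q$. A Girard quantaloid is a quantaloid equipped with a cyclic dualizing family. A $\mathcal{Q}$-category $\mathbb{A}$ is a set $\mathbb{A}_0$ with a type map $|\cdot|:\mathbb{A}_0\to\mathcal{Q}_0$ and arrows $\mathbb{A}(x,y)\in\mathcal{Q}(|x|,|y|)$ such that $1_{|x|}\leq\mathbb{A}(x,x)$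 and $\mathbb{A}(y,z)\circ\mathbb{A}(x,y)\leq\mathbb{A}(x,z)$. $x\leq y$ iff $|x|=|y|$ and $1_{|x|}\leq\mathbb{A}(x,y)$; $x\cong y$ means $x\leq y$ and $y\leq x$. A $\mathcal{Q}$-functor $F:\mathbb{A}\to\mathbb{B}$ is a map $\mathbb{A}_0\to\mathbb{B}_0$ preserving types with $\mathbb{A}(x,x')\leq\mathbb{B}(Fx,Fx')$. A $\mathcal{Q}$-distributor $\phi:\mathbb{A}\nrightarrow\mathbb{B}$ is a family of arrows $\phi(x,y):|x|\to|y|$ with $\mathbb{B}(y,y')\circ\phi(x,y)\circ\mathbb{A}(x',x)\leq\phi(x',y')$. For $\phi:\mathbb{A}\nrightarrow\mathbb{B}$, $\psi:\mathbb{B}\nrightarrow\mathbb{C}$, $\xi:\mathbb{A}\nrightarrow\mathbb{C}$: $(\xi\swarrow\phi)(y,z)=\bigwedge_{x}\xi(x,z)\swarrow\phi(x,y)$, $(\psi\searrow\xi)(x,y)=\bigwedge_{z}\psi(y,z)\searrow\xi(x,z)$. For $F:\mathbb{A}\to\mathbb{B}$, $F^\natural:\mathbb{B}\nrightarrow\mathbb{A}$ is $F^\natural(y,x)=\mathbb{B}(y,Fx)$. $\{q\}$ is the $\mathcal{Q}$-category with one object of type $q$ and hom-arrow $1_q$. $\mathsf{P}\mathbb{A}$ is the $\mathcal{Q}$-category of presheaves $\mu:\mathbb{A}\nrightarrow\{q\}$ (of type $q$, for all $q\in\mathcal{Q}_0$) with $\mathsf{P}\mathbb{A}(\mu,\mu')=\mu'\swarrow\mu$.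 $\mathsf{P}^\dagger\mathbb{A}$ consists of copresheaves $\lambda:\{q\}\nrightarrow\mathbb{A}$ (of type $q$). For $F:\mathbb{A}\to\mathbb{B}$, $\lambda\in\mathsf{P}^\dagger\mathbb{A}$, $\lim_\lambda F$ is an object of $\mathbb{B}$ of type $|\lambda|$ with $\mathbb{B}(-,\lim_\lambda F)=\lambda\searrow F^\natural$. $F:\mathbb{A}\to\mathbb{B}$ is codense if for every $y\in\mathbb{B}_0$ there is $\lambda\in\mathsf{P}^\dagger\mathbb{A}$ with $y\cong\lim_\lambda F$. -}

module Defs where

open import Level using (Level; Lift; lift; lower) renaming (suc to lsuc)
open import Data.Empty.Polymorphic using (⊥; ⊥-elim)
open import Data.Unit.Polymorphic using (⊤; tt)
open import Data.Bool using (Bool; true; false; if_then_else_)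
open import Data.Product using (Σ; Σ-syntax; _×_; _,_; proj₁; proj₂)
open import Function using (id)
open import Function.Bundles using (_⇔_; mk⇔; Equivalence)
open import Relation.Binary.Core using (Rel)
open import Relation.Binary.Structures using (IsPartialOrder)
open import Relation.Binary.PropositionalEquality using (_≡_; refl; sym; subst; subst₂)

-- A subset of A is presented as a family in A indexed by a type in the same
-- universe as A; the subset cut out by a predicate P is the family
-- proj₁ : Σ A P → A.
record IsCompleteLattice {ℓ} {A : Set ℓ} (_≈_ _≤_ : Rel A ℓ) : Set (lsuc ℓ) where
  field
    isPartialOrder : IsPartialOrder _≈_ _≤_
    ⋁              : {I : Set ℓ} → (I → A) → A
    ⋁-upper        : {I : Set ℓ} (f : I → A) (i : I) → f i ≤ ⋁ f
    ⋁-least        : {I : Set ℓ} (f : I → A) {a : A} → (∀ i → f i ≤ a) → ⋁ f ≤ a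

  module ≤ = IsPartialOrder isPartialOrder

  ⋀ : {I : Set ℓ} → (I → A) → A
  ⋀ {I} f = ⋁ {I = Σ[ a ∈ A ] (∀ i → a ≤ f i)} proj₁

  ⋀-lower : {I : Set ℓ} (f : I → A) (i : I) → ⋀ f ≤ f i
  ⋀-lower f i = ⋁-least proj₁ (λ b → proj₂ b i)

  ⋀-greatest : {I : Set ℓ} (f : I → A) {a : A} → (∀ i → a ≤ f i) → a ≤ ⋀ f
  ⋀-greatest f {a} a≤f = ⋁-upper proj₁ (a , a≤f)

  top : A
  top = ⋁ id

  top-greatest : ∀ a → a ≤ top
  top-greatest = ⋁-upper id

  bot : A
  bot = ⋁ {I = ⊥} ⊥-elim

  bot-least : ∀ a → bot ≤ a
  bot-least a = ⋁-least ⊥-elim (λ ())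

-- "Small" means that objects, arrows and the index types of joins all live in
-- the one universe Set ℓ. Arrows are compared by the equality _≈_ of the
-- hom-lattices, objects by _≡_.
record Quantaloid (ℓ : Level) : Set (lsuc ℓ) where
  infix  4 _≈_ _≤_
  infixr 9 _∘_
  infixl 7 _↙_
  infixr 7 _↘_
  field
    Obj               : Set ℓ
    Hom               : Obj → Obj → Set ℓ
    _≈_ _≤_           : ∀ {p q} → Rel (Hom p q) ℓ
    isCompleteLattice : ∀ p q → IsCompleteLattice (_≈_ {p} {q}) (_≤_ {p} {q})
    1#                : ∀ q → Hom q q
    _∘_               : ∀ {p q r} → Hom q r → Hom p q → Hom p r

  module Lattice {p q} = IsCompleteLattice (isCompleteLattice p q)
  open Lattice public using (⋁; ⋁-upper; ⋁-least; ⋀; ⋀-lower; ⋀-greatest)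
  module ≤ {p q} = IsPartialOrder (Lattice.isPartialOrder {p} {q})

  field
    ∘-cong    : ∀ {p q r} {v v′ : Hom q r} {u u′ : Hom p q} →
                v ≈ v′ → u ≈ u′ → v ∘ u ≈ v′ ∘ u′
    ∘-assoc   : ∀ {p q r s} (w : Hom r s) (v : Hom q r) (u : Hom p q) →
                (w ∘ v) ∘ u ≈ w ∘ (v ∘ u)
    identityˡ : ∀ {p q} (u : Hom p q) → 1# q ∘ u ≈ u
    identityʳ : ∀ {p q} (u : Hom p q) → u ∘ 1# p ≈ u
    ∘-distribˡ-⋁ : ∀ {p q r} {I : Set ℓ} (v : Hom q r) (u : I → Hom p q) →
                   v ∘ ⋁ u ≈ ⋁ (λ i → v ∘ u i)
    ∘-distribʳ-⋁ : ∀ {p q r} {I : Set ℓ} (v : I → Hom q r) (u : Hom p q) →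
                   ⋁ v ∘ u ≈ ⋁ (λ i → v i ∘ u)

  ⊤# : ∀ q → Hom q q
  ⊤# q = Lattice.top

  ⊥# : ∀ q → Hom q q
  ⊥# q = Lattice.bot

  _↙_ : ∀ {p q r} → Hom p r → Hom p q → Hom q r
  _↙_ {q = q} {r} w u = ⋁ {I = Σ[ v ∈ Hom q r ] (v ∘ u ≤ w)} proj₁

  _↘_ : ∀ {p q r} → Hom q r → Hom p r → Hom p q
  _↘_ {p} {q} v w = ⋁ {I = Σ[ u ∈ Hom p q ] (v ∘ u ≤ w)} proj₁

  ∘-monoˡ : ∀ {p q r} {v v′ : Hom q r} (u : Hom p q) → v ≤ v′ → v ∘ u ≤ v′ ∘ u
  ∘-monoˡ {q = q} {r} {v} {v′} u v≤v′ =
    ≤.trans (⋁-upper (λ i → f i ∘ u) (lift true))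
      (≤.trans (≤.reflexive (≤.Eq.sym (∘-distribʳ-⋁ f u)))
        (≤.reflexive (∘-cong (≤.antisym (⋁-least f below) (⋁-upper f (lift false))) ≤.Eq.refl)))
    where
    f : Lift ℓ Bool → Hom q r
    f b = if lower b then v else v′
    below : ∀ b → f b ≤ v′
    below (lift true)  = v≤v′
    below (lift false) = ≤.refl

  ∘-monoʳ : ∀ {p q r} (v : Hom q r) {u u′ : Hom p q} → u ≤ u′ → v ∘ u ≤ v ∘ u′
  ∘-monoʳ {p} {q} v {u} {u′} u≤u′ =
    ≤.trans (⋁-upper (λ i → v ∘ f i) (lift true))
      (≤.trans (≤.reflexive (≤.Eq.sym (∘-distribˡ-⋁ v f)))
        (≤.reflexive (∘-cong ≤.Eq.refl (≤.antisym (⋁-least f below) (⋁-upper f (lift false))))))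
    where
    f : Lift ℓ Bool → Hom p q
    f b = if lower b then u else u′
    below : ∀ b → f b ≤ u′
    below (lift true)  = u≤u′
    below (lift false) = ≤.refl

  ↙-residual : ∀ {p q r} {v : Hom q r} {u : Hom p q} {w : Hom p r} →
               v ∘ u ≤ w ⇔ v ≤ w ↙ u
  ↙-residual {v = v} {u} {w} = mk⇔
    (λ vu≤w → ⋁-upper proj₁ (v , vu≤w))
    (λ v≤w↙u → ≤.trans (∘-monoˡ u v≤w↙u)
      (≤.trans (≤.reflexive (∘-distribʳ-⋁ proj₁ u)) (⋁-least _ proj₂)))

  ↘-residual : ∀ {p q r} {v : Hom q r} {u : Hom p q} {w : Hom p r} →
               v ∘ u ≤ w ⇔ u ≤ v ↘ w
  ↘-residual {v = v} {u} {w} = mk⇔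
    (λ vu≤w → ⋁-upper proj₁ (u , vu≤w))
    (λ u≤v↘w → ≤.trans (∘-monoʳ v u≤v↘w)
      (≤.trans (≤.reflexive (∘-distribˡ-⋁ v proj₁)) (⋁-least _ proj₂)))

  IsCyclic : (∀ q → Hom q q) → Set ℓ
  IsCyclic d = ∀ {p q} (u : Hom p q) → d p ↙ u ≈ u ↘ d q

  IsDualizing : (∀ q → Hom q q) → Set ℓ
  IsDualizing d = ∀ {p q} (u : Hom p q) →
    ((d p ↙ u) ↘ d p ≈ u) × (u ≈ d q ↙ (u ↘ d q))

  -- (Q, d) is a Girard quantaloid.
  IsGirard : (∀ q → Hom q q) → Set ℓ
  IsGirard d = IsCyclic d × IsDualizing d

module _ {ℓ : Level} (Q : Quantaloid ℓ) where
  open Quantaloid Q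

  record QCategory : Set (lsuc ℓ) where
    field
      Ob     : Set ℓ
      type   : Ob → Obj
      hom    : ∀ x y → Hom (type x) (type y)
      hom-id : ∀ x → 1# (type x) ≤ hom x x
      hom-∘  : ∀ x y z → hom y z ∘ hom x y ≤ hom x z

    -- The arrow hom x y is transported along type x ≡ type y to an endo-arrow.
    _⊑_ : Ob → Ob → Set ℓ
    x ⊑ y = Σ[ e ∈ type x ≡ type y ]
              (1# (type x) ≤ subst (Hom (type x)) (sym e) (hom x y))

    _≅_ : Ob → Ob → Set ℓ
    x ≅ y = (x ⊑ y) × (y ⊑ x)

  module _ (A B : QCategory) where
    private
      module A = QCategory A
      module B = QCategory B

    record QFunctor : Set ℓ where
      field
        map      : A.Ob → B.Ob
        map-type : ∀ x → B.type (map x) ≡ A.type x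
        map-hom  : ∀ x x′ → A.hom x x′ ≤
                   subst₂ Hom (map-type x) (map-type x′) (B.hom (map x) (map x′))

    record QDistributor : Set ℓ where
      field
        arr     : ∀ x y → Hom (A.type x) (B.type y)
        arr-act : ∀ x x′ y y′ → B.hom y y′ ∘ arr x y ∘ A.hom x′ x ≤ arr x′ y′

module _ {ℓ : Level} {Q : Quantaloid ℓ} where
  open Quantaloid Q
  open QCategory
  open QFunctor
  open QDistributor

  private
    regroup : ∀ {p q r s t} (k : Hom s t) (h : Hom r s) (g : Hom q r) (f : Hom p q) →
              (k ∘ h ∘ g) ∘ f ≤ k ∘ h ∘ g ∘ f
    regroup k h g f = ≤.trans (≤.reflexive (∘-assoc k (h ∘ g) f))
                              (∘-monoʳ k (≤.reflexive (∘-assoc h g f)))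

  module _ {A B C : QCategory Q} where

    _⇙_ : QDistributor Q A C → QDistributor Q A B → QDistributor Q B C
    (ξ ⇙ φ) .arr y z = ⋀ λ x → arr ξ x z ↙ arr φ x y
    (ξ ⇙ φ) .arr-act y y′ z z′ = ⋀-greatest _ λ x → Equivalence.to ↙-residual
      (≤.trans (regroup _ _ _ _)
      (≤.trans (∘-monoʳ _ (∘-monoʳ _ (φ-act x)))
      (≤.trans (∘-monoʳ _ (Equivalence.from ↙-residual (⋀-lower _ x))) (ξ-act x))))
      where
      φ-act : ∀ x → hom B y′ y ∘ arr φ x y′ ≤ arr φ x y
      φ-act x = ≤.trans (∘-monoʳ _
        (≤.trans (≤.reflexive (≤.Eq.sym (identityʳ _))) (∘-monoʳ _ (hom-id A x))))
        (arr-act φ x x y′ y)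
      ξ-act : ∀ x → hom C z z′ ∘ arr ξ x z ≤ arr ξ x z′
      ξ-act x = ≤.trans (∘-monoʳ _
        (≤.trans (≤.reflexive (≤.Eq.sym (identityʳ _))) (∘-monoʳ _ (hom-id A x))))
        (arr-act ξ x x z z′)

    _⇘_ : QDistributor Q B C → QDistributor Q A C → QDistributor Q A B
    (ψ ⇘ ξ) .arr x y = ⋀ λ z → arr ψ y z ↘ arr ξ x z
    (ψ ⇘ ξ) .arr-act x x′ y y′ = ⋀-greatest _ λ z → Equivalence.to ↘-residual
      (≤.trans (≤.reflexive (≤.Eq.sym (∘-assoc _ _ _)))
      (≤.trans (∘-monoˡ _ (ψ-act z))
      (≤.trans (≤.reflexive (≤.Eq.sym (∘-assoc _ _ _)))
      (≤.trans (∘-monoˡ _ (Equivalence.from ↘-residual (⋀-lower _ z))) (ξ-act z)))))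
      where
      ψ-act : ∀ z → arr ψ y′ z ∘ hom B y y′ ≤ arr ψ y z
      ψ-act z = ≤.trans
        (≤.trans (≤.reflexive (≤.Eq.sym (identityˡ _))) (∘-monoˡ _ (hom-id C z)))
        (arr-act ψ y′ y z z)
      ξ-act : ∀ z → arr ξ x z ∘ hom A x′ x ≤ arr ξ x′ z
      ξ-act z = ≤.trans
        (≤.trans (≤.reflexive (≤.Eq.sym (identityˡ _))) (∘-monoˡ _ (hom-id C z)))
        (arr-act ξ x x′ z z)

  -- F^♮; the subst only identifies the type of F x with that of x.
  _♮ : {A B : QCategory Q} → QFunctor Q A B → QDistributor Q B A
  _♮ {A} {B} F .arr y x = subst (Hom (type B y)) (map-type F x) (hom B y (map F x))
  _♮ {A} {B} F .arr-act y y′ x x′ =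
    act (map-type F x) (map-type F x′) (map-hom F x x′)
      (≤.trans (≤.reflexive (≤.Eq.sym (∘-assoc _ _ _)))
        (≤.trans (∘-monoˡ _ (hom-∘ B y (map F x) (map F x′))) (hom-∘ B y′ y (map F x′))))
    where
    act : ∀ {p p′ a a′ b b′} (e : b ≡ a) (e′ : b′ ≡ a′)
          {f : Hom a a′} {k : Hom b b′} {g : Hom p b} {h : Hom p′ p} {l : Hom p′ b′} →
          f ≤ subst₂ Hom e e′ k → k ∘ g ∘ h ≤ l →
          f ∘ subst (Hom p) e g ∘ h ≤ subst (Hom p′) e′ l
    act refl refl f≤k kgh≤l = ≤.trans (∘-monoˡ _ f≤k) kgh≤l

module _ {ℓ : Level} (Q : Quantaloid ℓ) where
  open Quantaloid Q
  open QCategory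
  open QFunctor
  open QDistributor

  ⟪_⟫ : Obj → QCategory Q
  ⟪ q ⟫ = record
    { Ob     = ⊤
    ; type   = λ _ → q
    ; hom    = λ _ _ → 1# q
    ; hom-id = λ _ → ≤.refl
    ; hom-∘  = λ _ _ _ → ≤.reflexive (identityˡ _)
    }

  Presheaf Copresheaf : QCategory Q → Set ℓ
  Presheaf   A = Σ[ q ∈ Obj ] QDistributor Q A ⟪ q ⟫
  Copresheaf A = Σ[ q ∈ Obj ] QDistributor Q ⟪ q ⟫ A

  𝖯 : QCategory Q → QCategory Q
  𝖯 A = record
    { Ob     = Presheaf A
    ; type   = proj₁
    ; hom    = λ (_ , μ) (_ , μ′) → arr (μ′ ⇙ μ) tt tt
    ; hom-id = λ _ → ⋀-greatest _ λ _ → Equivalence.to ↙-residual (≤.reflexive (identityˡ _))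
    ; hom-∘  = λ _ _ _ → ⋀-greatest _ λ x → Equivalence.to ↙-residual
        (≤.trans (≤.reflexive (∘-assoc _ _ _))
        (≤.trans (∘-monoʳ _ (Equivalence.from ↙-residual (⋀-lower _ x)))
                 (Equivalence.from ↙-residual (⋀-lower _ x))))
    }

  module _ {A B : QCategory Q} where

    IsLimit : Copresheaf A → QFunctor Q A B → Ob B → Set ℓ
    IsLimit (q , λ′) F l = Σ[ e ∈ type B l ≡ q ]
      (∀ y → subst (Hom (type B y)) e (hom B y l) ≈ arr (λ′ ⇘ (F ♮)) y tt)

    IsCodense : QFunctor Q A B → Set ℓ
    IsCodense F = ∀ y → Σ[ λ′ ∈ Copresheaf A ] Σ[ l ∈ Ob B ]
      (IsLimit λ′ F l × _≅_ B y l)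

{-# OPTIONS --safe #-}
module Submission where

-- Write ¬ u = u ↘ ⊥ for the negation of an arrow u. Since the bottom arrows
-- form a cyclic family, v ∘ u ≤ ⊥ is equivalent to u ∘ v ≤ ⊥, so v ≤ ¬ u can
-- be tested by composing on either side, and the family is dualizing exactly
-- when ¬ ¬ u ≈ u for every arrow u.
--
-- Suppose that the family is dualizing. Negation turns a distributor A ⇸ B
-- into a distributor B ⇸ A (∁), and F x = ∁ A(x,-) defines a functor A → 𝖯 A.
-- A Yoneda-type computation gives 𝖯 A(μ, F x) ≈ ¬ μ(x) (hom-∁corep). Every
-- presheaf ν is therefore the limit of F weighted by ∁ ν, because
--   ⋀ₓ ¬ ν(x) ↘ ¬ μ(x) ≈ ⋀ₓ ¬ ¬ ν(x) ↙ μ(x) ≈ ⋀ₓ ν(x) ↙ μ(x) = 𝖯 A(μ, ν).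
--
-- Conversely, suppose that codense functors exist and take one for the
-- one-object category ⟪ p ⟫, whose presheaves are the arrows with domain p. A
-- functor ⟪ p ⟫ → 𝖯 ⟪ p ⟫ amounts to an arrow d : p → p, and evaluating limits
-- at the presheaf 1# p shows that codensity makes every u : p → q of the form
-- l ↘ d (codense⇒residual). Any l : p → p satisfies l ≤ 1# p because 1# p is
-- the top arrow, hence d ≤ l ↘ d; for u = ⊥ this gives d ≤ ⊥. So every arrow
-- with domain p is of the form l ↘ ⊥ = ¬ l, and negations satisfy ¬ ¬ ¬ l ≈ ¬ l.

open import Defs
open import Level using (Level)
open import Data.Product using (Σ; Σ-syntax; _×_; _,_; proj₁; proj₂)
open import Data.Unit.Polymorphic using (tt)
open import Function.Bundles using (_⇔_; mk⇔; Equivalence)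
open import Relation.Binary.PropositionalEquality using (_≡_; refl; subst)

module _ {ℓ : Level} (Q : Quantaloid ℓ) where
  open Quantaloid Q
  open QCategory
  open QFunctor
  open QDistributor

  private
    variable
      p q r s : Obj

  ↙-intro : {v : Hom q r} {u : Hom p q} {w : Hom p r} → v ∘ u ≤ w → v ≤ w ↙ u
  ↙-intro = Equivalence.to ↙-residual

  ↙-elim : {v : Hom q r} {u : Hom p q} {w : Hom p r} → v ≤ w ↙ u → v ∘ u ≤ w
  ↙-elim = Equivalence.from ↙-residual

  ↘-intro : {v : Hom q r} {u : Hom p q} {w : Hom p r} → v ∘ u ≤ w → u ≤ v ↘ w
  ↘-intro = Equivalence.to ↘-residual

  ↘-elim : {v : Hom q r} {u : Hom p q} {w : Hom p r} → u ≤ v ↘ w → v ∘ u ≤ w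
  ↘-elim = Equivalence.from ↘-residual

  assoc-≤ : (w : Hom r s) (v : Hom q r) (u : Hom p q) → (w ∘ v) ∘ u ≤ w ∘ (v ∘ u)
  assoc-≤ w v u = ≤.reflexive (∘-assoc w v u)

  assoc-≥ : (w : Hom r s) (v : Hom q r) (u : Hom p q) → w ∘ (v ∘ u) ≤ (w ∘ v) ∘ u
  assoc-≥ w v u = ≤.reflexive (≤.Eq.sym (∘-assoc w v u))

  insert-idˡ : (u : Hom p q) {e : Hom q q} → 1# q ≤ e → u ≤ e ∘ u
  insert-idˡ u 1≤e = ≤.trans (≤.reflexive (≤.Eq.sym (identityˡ u))) (∘-monoˡ u 1≤e)

  insert-idʳ : (u : Hom p q) {e : Hom p p} → 1# p ≤ e → u ≤ u ∘ e
  insert-idʳ u 1≤e = ≤.trans (≤.reflexive (≤.Eq.sym (identityʳ u))) (∘-monoʳ u 1≤e)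

  ⋀-mono : {I : Set ℓ} {f g : I → Hom p q} → (∀ i → f i ≤ g i) → ⋀ f ≤ ⋀ g
  ⋀-mono {f = f} {g} f≤g = ⋀-greatest g λ i → ≤.trans (⋀-lower f i) (f≤g i)

  -- The action of A alone on a presheaf, without the identity on the other side.
  restrict : {A : QCategory Q} (μ : QDistributor Q A (⟪_⟫ Q q)) (x y : Ob A) →
             arr μ y tt ∘ hom A x y ≤ arr μ x tt
  restrict μ x y = ≤.trans (insert-idˡ _ ≤.refl) (arr-act μ y x tt tt)

  -- The corepresentable distributor A(x,-).
  corep : (A : QCategory Q) (x : Ob A) → QDistributor Q (⟪_⟫ Q (type A x)) A
  corep A x .arr _ y = hom A x y
  corep A x .arr-act _ _ y y′ =
    ≤.trans (∘-monoʳ _ (≤.reflexive (identityʳ _))) (hom-∘ A x y y′)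

  -- Negation relative to the family of bottom arrows.
  ¬_ : Hom p q → Hom q p
  ¬_ {q = q} u = u ↘ ⊥# q

  infix 10 ¬_

  ∘-¬ : (u : Hom p q) → u ∘ ¬ u ≤ ⊥# q
  ∘-¬ u = ↘-elim ≤.refl

  module _ (cyclic : IsCyclic ⊥#) where

    -- Cyclicity in residuated form.
    ⊥-rotate : {v : Hom q p} {u : Hom p q} → v ∘ u ≤ ⊥# p → u ∘ v ≤ ⊥# q
    ⊥-rotate {u = u} vu≤⊥ =
      ↘-elim (≤.trans (↙-intro vu≤⊥) (≤.reflexive (cyclic u)))

    ≤¬-intro : {v : Hom q p} {u : Hom p q} → v ∘ u ≤ ⊥# p → v ≤ ¬ u
    ≤¬-intro vu≤⊥ = ↘-intro (⊥-rotate vu≤⊥)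

    ≤¬-elim : {v : Hom q p} {u : Hom p q} → v ≤ ¬ u → v ∘ u ≤ ⊥# p
    ≤¬-elim v≤¬u = ⊥-rotate (↘-elim v≤¬u)

    ¬¬-intro : (u : Hom p q) → u ≤ ¬ ¬ u
    ¬¬-intro u = ≤¬-intro (∘-¬ u)

    ¬-anti : {u v : Hom p q} → u ≤ v → ¬ v ≤ ¬ u
    ¬-anti {v = v} u≤v = ↘-intro (≤.trans (∘-monoˡ _ u≤v) (∘-¬ v))

    -- By cyclicity both dualizing equations say that ¬ ¬ u ≈ u, and one of the
    -- two inequalities always holds.
    dualizing⇒¬¬-elim : IsDualizing ⊥# → (u : Hom p q) → ¬ ¬ u ≤ u
    dualizing⇒¬¬-elim dualizing u =
      ≤.reflexive (≤.Eq.sym (≤.Eq.trans (proj₂ (dualizing u)) (cyclic (¬ u))))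

    ¬¬-elim⇒dualizing : (∀ {p q} (u : Hom p q) → ¬ ¬ u ≤ u) → IsDualizing ⊥#
    ¬¬-elim⇒dualizing ¬¬-elim {p} {q} u =
      ≤.antisym
        (≤.trans (¬-anti (≤.reflexive (≤.Eq.sym (cyclic u)))) (¬¬-elim u))
        (≤.trans (¬¬-intro u) (¬-anti (≤.reflexive (cyclic u)))) ,
      ≤.Eq.trans (≤.antisym (¬¬-intro u) (¬¬-elim u)) (≤.Eq.sym (cyclic (¬ u)))

    -- The pointwise negation of a distributor, in the opposite direction.
    ∁ : {A B : QCategory Q} → QDistributor Q A B → QDistributor Q B A
    ∁ φ .arr y x = ¬ arr φ x y
    ∁ φ .arr-act y y′ x x′ = ≤¬-intro
      (≤.trans (assoc-≤ _ _ _)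
        -- Rotating A(x,x′) to the right makes it act on φ(x′,y′).
        (⊥-rotate
          (≤.trans (assoc-≤ _ _ _)
          (≤.trans (assoc-≤ _ _ _)
          (≤.trans (∘-monoʳ _ (arr-act φ x′ x y′ y)) (≤¬-elim ≤.refl))))))

    module _ (A : QCategory Q) where

      -- The presheaf ∁ A(x,-), with value ¬ A(x,y) at y.
      ∁corep : Ob A → Presheaf Q A
      ∁corep x = type A x , ∁ (corep A x)

      -- The two halves of 𝖯 A(μ, ∁ A(x,-)) ≈ ¬ μ(x).
      hom-∁corep-≤ : (μ : Presheaf Q A) (x : Ob A) →
                     hom (𝖯 Q A) μ (∁corep x) ≤ ¬ arr (proj₂ μ) x tt
      hom-∁corep-≤ (_ , μ) x = ≤¬-intro
        (≤.trans (↙-elim (⋀-lower _ x))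
        (≤.trans (insert-idˡ _ (hom-id A x)) (∘-¬ (hom A x x))))

      hom-∁corep-≥ : (μ : Presheaf Q A) (x : Ob A) →
                     ¬ arr (proj₂ μ) x tt ≤ hom (𝖯 Q A) μ (∁corep x)
      hom-∁corep-≥ (_ , μ) x = ⋀-greatest _ λ y → ↙-intro (≤¬-intro
        (≤.trans (assoc-≤ _ _ _)
        (≤.trans (∘-monoʳ _ (restrict μ x y)) (≤¬-elim ≤.refl))))

      -- On homs this is A(x,x′) ≤ ¬ ¬ A(x,x′) ≈ 𝖯 A(∁ A(x,-), ∁ A(x′,-)).
      ∁corep-functor : QFunctor Q A (𝖯 Q A)
      ∁corep-functor .map = ∁corep
      ∁corep-functor .map-type _ = refl
      ∁corep-functor .map-hom x x′ =
        ≤.trans (¬¬-intro (hom A x x′)) (hom-∁corep-≥ (∁corep x) x′)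

      ∁corep-codense : IsDualizing ⊥# → IsCodense Q ∁corep-functor
      ∁corep-codense dualizing (q , ν) =
        (q , ∁ ν) , (q , ν) , (refl , limit) , (reflexive , reflexive)
        where
        reflexive : _⊑_ (𝖯 Q A) (q , ν) (q , ν)
        reflexive = refl , hom-id (𝖯 Q A) (q , ν)

        limit : ∀ μ → hom (𝖯 Q A) μ (q , ν) ≈
                      arr (∁ ν ⇘ (_♮ {B = 𝖯 Q A} ∁corep-functor)) μ tt
        limit μ = ≤.antisym
          -- Pointwise, ν(x) ↙ μ(x) ≤ ¬ ν(x) ↘ ¬ μ(x), and conversely
          -- ¬ ν(x) ↘ ¬ μ(x) ≤ ¬ ¬ ν(x) ↙ μ(x) ≤ ν(x) ↙ μ(x).
          (⋀-mono λ x → ↘-intro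
            (≤.trans
              (≤¬-intro
                (≤.trans (assoc-≤ _ _ _)
                (≤.trans (∘-monoʳ _ (↙-elim ≤.refl)) (≤¬-elim ≤.refl))))
              (hom-∁corep-≥ μ x)))
          (⋀-mono λ x → ↙-intro
            (≤.trans
              (↘-intro
                (≤.trans (assoc-≥ _ _ _)
                  (≤¬-elim (≤.trans (↘-elim ≤.refl) (hom-∁corep-≤ μ x)))))
              (dualizing⇒¬¬-elim dualizing _)))

  -- Presheaves on ⟪ p ⟫ are arrows with domain p.
  arrow : Hom p q → Presheaf Q (⟪_⟫ Q p)
  arrow {q = q} u = q , record
    { arr     = λ _ _ → u
    ; arr-act = λ _ _ _ _ →
        ≤.reflexive (≤.Eq.trans (identityˡ _) (identityʳ u))
    }

  -- The presheaf 1# p is representable, so a hom out of it evaluates its target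
  -- (Yoneda). The type of ν is identified with q along e.
  hom-from-1 : (ν : Presheaf Q (⟪_⟫ Q p)) (e : proj₁ ν ≡ q) →
               subst (Hom p) e (hom (𝖯 Q (⟪_⟫ Q p)) (arrow (1# p)) ν) ≈
               subst (Hom p) e (arr (proj₂ ν) tt tt)
  hom-from-1 ν refl = ≤.antisym
    (≤.trans (insert-idʳ _ ≤.refl) (↙-elim (⋀-lower _ tt)))
    (⋀-greatest _ λ _ → ↙-intro (≤.reflexive (identityʳ _)))

  -- The underlying order of 𝖯 ⟪ p ⟫ is the order of arrows. The identification e
  -- of types may differ from the one carried by the proof of ⊑, which uniqueness
  -- of identity proofs makes irrelevant.
  ⊑⇒≤ : (μ ν : Presheaf Q (⟪_⟫ Q p)) (e : proj₁ ν ≡ proj₁ μ) →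
        _⊑_ (𝖯 Q (⟪_⟫ Q p)) μ ν →
        arr (proj₂ μ) tt tt ≤ subst (Hom p) e (arr (proj₂ ν) tt tt)
  ⊑⇒≤ μ ν refl (refl , 1≤hom) =
    ≤.trans (insert-idˡ _ ≤.refl) (↙-elim (≤.trans 1≤hom (⋀-lower _ tt)))

  ⊑⇒≥ : (μ ν : Presheaf Q (⟪_⟫ Q p)) (e : proj₁ ν ≡ proj₁ μ) →
        _⊑_ (𝖯 Q (⟪_⟫ Q p)) ν μ →
        subst (Hom p) e (arr (proj₂ ν) tt tt) ≤ arr (proj₂ μ) tt tt
  ⊑⇒≥ μ ν refl (refl , 1≤hom) =
    ≤.trans (insert-idˡ _ ≤.refl) (↙-elim (≤.trans 1≤hom (⋀-lower _ tt)))

  -- The arrow p → p that a functor ⟪ p ⟫ → 𝖯 ⟪ p ⟫ picks out.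
  value : QFunctor Q (⟪_⟫ Q p) (𝖯 Q (⟪_⟫ Q p)) → Hom p p
  value {p} F = subst (Hom p) (map-type F tt) (arr (proj₂ (map F tt)) tt tt)

  -- If u is the limit of F weighted by l, then the limit formula at the presheaf
  -- 1# p reads u ≈ l ↘ value F.
  codense⇒residual : (F : QFunctor Q (⟪_⟫ Q p) (𝖯 Q (⟪_⟫ Q p))) → IsCodense Q F →
                     (u : Hom p q) → Σ[ l ∈ Hom q p ] (u ≈ l ↘ value F)
  codense⇒residual {p} F codense u with codense (arrow u)
  ... | (_ , l) , ν , (refl , limit) , (u⊑ν@(refl , _) , ν⊑u) =
    arr l tt tt , ≤.antisym
      (≤.trans (⊑⇒≤ (arrow u) ν refl u⊑ν)
      (≤.trans (≤.reflexive (≤.Eq.sym (hom-from-1 ν refl)))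
      (≤.trans (≤.reflexive (limit (arrow (1# p))))
      (≤.trans (⋀-lower _ tt)
      (↘-intro (≤.trans (↘-elim ≤.refl)
        (≤.reflexive (hom-from-1 (map F tt) (map-type F tt)))))))))
      (≤.trans
        (⋀-greatest _ λ _ → ↘-intro (≤.trans (↘-elim ≤.refl)
          (≤.reflexive (≤.Eq.sym (hom-from-1 (map F tt) (map-type F tt))))))
      (≤.trans (≤.reflexive (≤.Eq.sym (limit (arrow (1# p)))))
      (≤.trans (≤.reflexive (hom-from-1 ν refl))
      (⊑⇒≥ (arrow u) ν refl ν⊑u))))

  module _ (1≈⊤ : ∀ q → 1# q ≈ ⊤# q) where

    ≤1 : (u : Hom q q) → u ≤ 1# q
    ≤1 u = ≤.trans (Lattice.top-greatest u) (≤.reflexive (≤.Eq.sym (1≈⊤ _)))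

    -- If every endo-arrow, in particular ⊥, is a residual of d, then d is ⊥.
    residuals⇒⊥ : (d : Hom p p) → ((u : Hom p p) → Σ[ l ∈ Hom p p ] (u ≈ l ↘ d)) →
                  d ≤ ⊥# p
    residuals⇒⊥ {p} d residual with residual (⊥# p)
    ... | l , ⊥≈l↘d = ≤.trans
      (↘-intro (≤.trans (∘-monoˡ d (≤1 l)) (≤.reflexive (identityˡ d))))
      (≤.reflexive (≤.Eq.sym ⊥≈l↘d))

    -- With u ≈ l ↘ d and d ≤ ⊥ it follows that l ≤ ¬ u, so l ∘ ¬ ¬ u ≤ ⊥ ≤ d.
    codense⇒¬¬-elim : IsCyclic ⊥# →
      ((A : QCategory Q) → Σ[ F ∈ QFunctor Q A (𝖯 Q A) ] IsCodense Q F) →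
      (u : Hom p q) → ¬ ¬ u ≤ u
    codense⇒¬¬-elim {p} cyclic existence u with existence (⟪_⟫ Q p)
    ... | F , codense with codense⇒residual F codense u
    ... | l , u≈l↘d =
      ≤.trans (↘-intro l∘¬¬u≤d) (≤.reflexive (≤.Eq.sym u≈l↘d))
      where
      l≤¬u : l ≤ ¬ u
      l≤¬u = ≤¬-intro cyclic
        (≤.trans (↘-elim (≤.reflexive u≈l↘d))
          (residuals⇒⊥ (value F) (codense⇒residual F codense)))

      l∘¬¬u≤d : l ∘ ¬ ¬ u ≤ value F
      l∘¬¬u≤d = ≤.trans (∘-monoˡ _ l≤¬u)
        (≤.trans (∘-¬ (¬ u)) (Lattice.bot-least _))

proposition6p10 : {ℓ : Level} (Q : Quantaloid ℓ) (let open Quantaloid Q) →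
    (∀ q → 1# q ≈ ⊤# q) → IsCyclic ⊥# →
    (IsDualizing ⊥# → IsGirard ⊥#) ×
    (IsDualizing ⊥# ⇔ ((A : QCategory Q) → Σ[ F ∈ QFunctor Q A (𝖯 Q A) ] IsCodense Q F))
proposition6p10 Q 1≈⊤ cyclic =
  (λ dualizing → (λ {_} {_} → cyclic) , (λ {_} {_} → dualizing)) , mk⇔ existence dualizing
  where
  open Quantaloid Q

  existence : IsDualizing ⊥# → (A : QCategory Q) →
              Σ[ F ∈ QFunctor Q A (𝖯 Q A) ] IsCodense Q F
  existence dualizing A = ∁corep-functor Q cyclic A , ∁corep-codense Q cyclic A dualizing

  dualizing : ((A : QCategory Q) → Σ[ F ∈ QFunctor Q A (𝖯 Q A) ] IsCodense Q F) →
              IsDualizing ⊥#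
  dualizing ex = ¬¬-elim⇒dualizing Q cyclic (codense⇒¬¬-elim Q 1≈⊤ cyclic ex)
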